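{- A $3$-connected matroid $M$ is quasi-graphic if and only if there exists a graph $G$ such that (i) $E(G)=E(M)$, (ii) $G$ is connected, (iii) $r(M)\le |V(G)|$, and (iv) for each vertex $v$ of $G$ we have $\mathrm{cl}_M(E(G-v))\subseteq E(G-v)\cup \mathrm{loops}_G(v)$.
   Context: For a graph $G$ and a vertex $v$, $\mathrm{loops}_G(v)$ denotes the set of loop-edges of $G$ at $v$. Graphs are finite and may have loops and parallel edges; the graph with no vertices is considered connected. For a set $X$ of edges, $G[X]$ is the subgraph of $G$ with edge-set $X$ and no isolated vertices. A graph $G$ is a framework for a matroid $M$ if (1) $E(G)=E(M)$; (2) $r_M(E(H))\le |V(H)|$ for each component $H$ of $G$; (3) for each vertex $v$ of $G$, $\mathrm{cl}_M(E(G-v))\subseteq E(G-v)\cup \mathrm{loops}_G(v)$; and (4) for each circuit $C$ of $M$, the subgraph $G[C]$ has at most two components. A matroid is quasi-graphic if it has a framework. -}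

module Defs where

open import Data.Nat using (ℕ; _≤_; _<_; _+_)
open import Data.Fin using (Fin)
open import Data.Fin.Subset using (Subset; _∈_; _∉_; _⊆_; _⊂_; _∪_; _∩_; ∁; ⁅_⁆; ⊤; ∣_∣; inside; outside)
open import Data.Fin.Properties using () renaming (_≟_ to _≟ᶠ_)
open import Data.Nat.Properties using () renaming (_≟_ to _≟ℕ_)
open import Data.Vec using (tabulate)
open import Data.Bool using (Bool; true; false; not; _∧_; _∨_)
open import Data.Product using (Σ; ∃; ∃-syntax; _×_; _,_; proj₁; proj₂)
open import Data.Sum using (_⊎_)
open import Relation.Nullary using (¬_)
open import Relation.Nullary.Decidable using (isYes)
open import Relation.Binary.PropositionalEquality using (_≡_)

record Matroid (n : ℕ) : Set where
  field
    r        : Subset n → ℕ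
    r-bound  : ∀ X → r X ≤ ∣ X ∣
    r-mono   : ∀ X Y → X ⊆ Y → r X ≤ r Y
    r-submod : ∀ X Y → r (X ∪ Y) + r (X ∩ Y) ≤ r X + r Y

open Matroid public

module _ {n : ℕ} (M : Matroid n) where

  rM : ℕ
  rM = r M ⊤

  Independent : Subset n → Set
  Independent X = r M X ≡ ∣ X ∣

  IsCircuit : Subset n → Set
  IsCircuit C = (¬ Independent C) × (∀ D → D ⊂ C → Independent D)

  cl : Subset n → Subset n
  cl X = tabulate (λ e → isYes (r M (X ∪ ⁅ e ⁆) ≟ℕ r M X))

  IsSeparation : ℕ → Subset n → Set
  IsSeparation k X = (k ≤ ∣ X ∣) × (k ≤ ∣ ∁ X ∣) × (r M X + r M (∁ X) < rM + k)

  ThreeConnected : Set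
  ThreeConnected = ∀ k → k < 3 → ∀ X → ¬ IsSeparation k X

record Graph (n m : ℕ) : Set where
  field
    ends : Fin n → Fin m × Fin m

open Graph public

module _ {n m : ℕ} (G : Graph n m) where

  IsEnd : Fin m → Fin n → Set
  IsEnd v e = (proj₁ (ends G e) ≡ v) ⊎ (proj₂ (ends G e) ≡ v)

  data Reach (X : Subset n) : Fin m → Fin m → Set where
    here : ∀ {u} → Reach X u u
    fwd  : ∀ {u} e → e ∈ X → Reach X u (proj₁ (ends G e)) → Reach X u (proj₂ (ends G e))
    bwd  : ∀ {u} e → e ∈ X → Reach X u (proj₂ (ends G e)) → Reach X u (proj₁ (ends G e))

  Connected : Set
  Connected = ∀ u w → Reach ⊤ u w

  edgesDel : Fin m → Subset n
  edgesDel v = tabulate (λ e → not (isYes (proj₁ (ends G e) ≟ᶠ v)) ∧ not (isYes (proj₂ (ends G e) ≟ᶠ v)))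

  loopsAt : Fin m → Subset n
  loopsAt v = tabulate (λ e → isYes (proj₁ (ends G e) ≟ᶠ v) ∧ isYes (proj₂ (ends G e) ≟ᶠ v))

  IsComponentOf : Fin m → Subset m → Subset n → Set
  IsComponentOf v S X =
    (∀ w → (w ∈ S → Reach ⊤ v w) × (Reach ⊤ v w → w ∈ S)) ×
    (∀ e → (e ∈ X → ∃[ w ] (IsEnd w e × w ∈ S)) × (∃[ w ] (IsEnd w e × w ∈ S) → e ∈ X))

  -- G[X] (edge set X, no isolated vertices) has at most two components
  AtMostTwoComponents : Subset n → Set
  AtMostTwoComponents X =
    ∃[ a ] ∃[ b ] (∀ e → e ∈ X → ∀ w → IsEnd w e → Reach X a w ⊎ Reach X b w)

-- Frameworks and quasi-graphic matroids.  E(G) = E(M) is built in: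
-- both have edge/element set Fin n.

IsFramework : {n m : ℕ} → Matroid n → Graph n m → Set
IsFramework {n} {m} M G =
  (∀ v S X → IsComponentOf G v S X → r M X ≤ ∣ S ∣) ×
  (∀ v → cl M (edgesDel G v) ⊆ (edgesDel G v ∪ loopsAt G v)) ×
  (∀ C → IsCircuit M C → AtMostTwoComponents G C)

QuasiGraphic : {n : ℕ} → Matroid n → Set
QuasiGraphic {n} M = ∃[ m ] Σ (Graph n m) (λ G → IsFramework M G)

{-# OPTIONS --safe #-}
module Submission where

-- Deleting the vertices outside a vertex set U one at a time, each of them joined to
-- what remains, costs at least one rank each by (iv); so r(Y[U]) + |V ∖ U| ≤ r(Y)
-- whenever Y reaches every vertex from U.
--
-- Forwards: this inequality together with r(E(H)) ≤ |V(H)| makes every component H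
-- 2-separating, so if r(M) ≥ 2 some component contains all but at most one edge. That
-- component has full rank, and collapsing the other vertices into it keeps (iv).
--
-- Backwards: suppose G[C] has at least three components for a circuit C. Connectivity
-- of G gives a vertex set W, connected in G, containing exactly two of them, V₁ and V₂.
-- The inequality gives r(E(G[W])) ≤ |W| and |C ∩ E(G[V₁])| ≥ |V₁|. Submodularity for
-- E(G[W]) and C then bounds r(E(G[W]) ∪ C) above by less than the inequality with
-- U = V₁ ∪ (V ∖ W) bounds it below.

open import Defs
open import Data.Bool using (true; not; _∧_)
open import Data.Fin using (Fin; zero; suc; fromℕ<)
open import Data.Fin.Properties using (any?; _≟_)
open import Data.Fin.Subset
  using (Subset; _∈_; _∉_; _⊆_; _⊂_; _∪_; _∩_; ∁; ⁅_⁆; ⊤; ⊥; ∣_∣; inside; outside)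
open import Data.Fin.Subset.Induction using (⊂-wellFounded; ⊃-wellFounded; Acc; acc)
open import Data.Fin.Subset.Properties
open import Data.Nat using (ℕ; zero; suc; _+_; _≤_; _<_; z≤n; s≤s; s≤s⁻¹; _≤?_)
open import Data.Nat.Properties renaming (_≟_ to _≟ⁿ_)
open import Data.Nat.Tactic.RingSolver using (solve-∀)
open import Data.Product using (Σ; ∃-syntax; _×_; _,_; proj₁; proj₂)
open import Data.Sum using (_⊎_; inj₁; inj₂; [_,_]′)
open import Data.Vec using ([]; _∷_; tabulate; here; there)
open import Data.Vec.Properties using (lookup∘tabulate; []=⇒lookup; lookup⇒[]=)
open import Function.Bundles using (_⇔_; mk⇔)
open import Relation.Binary.PropositionalEquality
  using (_≡_; _≢_; refl; sym; trans; cong; subst)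
open import Relation.Nullary using (¬_; Dec; yes; no; contradiction)
open import Relation.Nullary.Decidable using (isYes; ¬?; _×-dec_; _⊎-dec_)

-- Finite subsets: decidable comprehension, cardinalities, enumeration.

separate : ∀ {n} {P : Fin n → Set} → (∀ i → Dec (P i)) → Subset n
separate P? = tabulate (λ i → isYes (P? i))

module _ {n : ℕ} {P : Fin n → Set} (P? : ∀ i → Dec (P i)) where

  ∈-separate⁺ : ∀ {i} → P i → i ∈ separate P?
  ∈-separate⁺ {i} p = lookup⇒[]= i _ (trans (lookup∘tabulate _ i) eq)
    where
    eq : isYes (P? i) ≡ true
    eq with P? i
    ... | yes _ = refl
    ... | no ¬p = contradiction p ¬p

  ∈-separate⁻ : ∀ {i} → i ∈ separate P? → P i
  ∈-separate⁻ {i} i∈ with P? i | trans (sym (lookup∘tabulate (λ j → isYes (P? j)) i)) ([]=⇒lookup i∈)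
  ... | yes p | _ = p

∣p∣≡∣p∩q∣+∣p∩∁q∣ : ∀ {n} (p q : Subset n) → ∣ p ∣ ≡ ∣ p ∩ q ∣ + ∣ p ∩ ∁ q ∣
∣p∣≡∣p∩q∣+∣p∩∁q∣ []            []            = refl
∣p∣≡∣p∩q∣+∣p∩∁q∣ (inside  ∷ p) (inside  ∷ q) = cong suc (∣p∣≡∣p∩q∣+∣p∩∁q∣ p q)
∣p∣≡∣p∩q∣+∣p∩∁q∣ (inside  ∷ p) (outside ∷ q) =
  trans (cong suc (∣p∣≡∣p∩q∣+∣p∩∁q∣ p q)) (sym (+-suc ∣ p ∩ q ∣ ∣ p ∩ ∁ q ∣))
∣p∣≡∣p∩q∣+∣p∩∁q∣ (outside ∷ p) (inside  ∷ q) = ∣p∣≡∣p∩q∣+∣p∩∁q∣ p q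
∣p∣≡∣p∩q∣+∣p∩∁q∣ (outside ∷ p) (outside ∷ q) = ∣p∣≡∣p∩q∣+∣p∩∁q∣ p q

⊆∪⇒∣p∣≤∣p∩q∣+∣p∩r∣ : ∀ {n} {p q r : Subset n} → p ⊆ q ∪ r → ∣ p ∣ ≤ ∣ p ∩ q ∣ + ∣ p ∩ r ∣
⊆∪⇒∣p∣≤∣p∩q∣+∣p∩r∣ {p = p} {q} {r} p⊆q∪r = begin
  ∣ p ∣                       ≡⟨ ∣p∣≡∣p∩q∣+∣p∩∁q∣ p q ⟩
  ∣ p ∩ q ∣ + ∣ p ∩ ∁ q ∣     ≤⟨ +-monoʳ-≤ ∣ p ∩ q ∣ (p⊆q⇒∣p∣≤∣q∣ rest) ⟩
  ∣ p ∩ q ∣ + ∣ p ∩ r ∣       ∎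
  where
  open ≤-Reasoning
  rest : p ∩ ∁ q ⊆ p ∩ r
  rest i with x∈p∩q⁻ p (∁ q) i
  ... | i∈p , i∉q with x∈p∪q⁻ q r (p⊆q∪r i∈p)
  ... | inj₁ i∈q = contradiction i∈q (x∈∁p⇒x∉p i∉q)
  ... | inj₂ i∈r = x∈p∩q⁺ (i∈p , i∈r)

∣p∣≤1+∣p∩∁⁅x⁆∣ : ∀ {n} (p : Subset n) x → ∣ p ∣ ≤ suc ∣ p ∩ ∁ ⁅ x ⁆ ∣
∣p∣≤1+∣p∩∁⁅x⁆∣ p x = begin
  ∣ p ∣                                ≡⟨ ∣p∣≡∣p∩q∣+∣p∩∁q∣ p ⁅ x ⁆ ⟩
  ∣ p ∩ ⁅ x ⁆ ∣ + ∣ p ∩ ∁ ⁅ x ⁆ ∣      ≤⟨ +-monoˡ-≤ _ (∣p∩q∣≤∣q∣ p ⁅ x ⁆) ⟩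
  ∣ ⁅ x ⁆ ∣ + ∣ p ∩ ∁ ⁅ x ⁆ ∣          ≡⟨ cong (_+ ∣ p ∩ ∁ ⁅ x ⁆ ∣) (∣⁅x⁆∣≡1 x) ⟩
  suc ∣ p ∩ ∁ ⁅ x ⁆ ∣                  ∎
  where open ≤-Reasoning

∣p∣+∣∁p∣≡n : ∀ {n} (p : Subset n) → ∣ p ∣ + ∣ ∁ p ∣ ≡ n
∣p∣+∣∁p∣≡n {n} p = trans (cong (∣ p ∣ +_) (∣∁p∣≡n∸∣p∣ p)) (m+[n∸m]≡n (∣p∣≤n p))

-- The vertex map for collapsing a graph onto `S`: `retr` renumbers `S` as `Fin ∣ S ∣` and sends
-- every outside vertex to the number of `h`.
record Retract {m} (S : Subset m) (h : Fin m) : Set where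
  field
    incl      : Fin ∣ S ∣ → Fin m
    retr      : Fin m → Fin ∣ S ∣
    incl∈     : ∀ i → incl i ∈ S
    retr-incl : ∀ i → retr (incl i) ≡ i
    incl-retr : ∀ {v} → v ∈ S → incl (retr v) ≡ v
    retr-out  : ∀ {v} → v ∉ S → retr v ≡ retr h

record Enumeration {m} (S : Subset m) : Set where
  field
    incl       : Fin ∣ S ∣ → Fin m
    index      : ∀ {v} → v ∈ S → Fin ∣ S ∣
    incl∈      : ∀ i → incl i ∈ S
    index-incl : ∀ i (p : incl i ∈ S) → index p ≡ i
    incl-index : ∀ {v} (p : v ∈ S) → incl (index p) ≡ v

enumerate : ∀ {m} (S : Subset m) → Enumeration S
enumerate [] = record { incl = λ () ; index = λ () ; incl∈ = λ () ; index-incl = λ () ; incl-index = λ () }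
enumerate (outside ∷ S) = record
  { incl = λ i → suc (E.incl i)
  ; index = λ { (there p) → E.index p }
  ; incl∈ = λ i → there (E.incl∈ i)
  ; index-incl = λ { i (there p) → E.index-incl i p }
  ; incl-index = λ { (there p) → cong suc (E.incl-index p) } }
  where module E = Enumeration (enumerate S)
enumerate {suc m} (inside ∷ S) = record
  { incl = incl′
  ; index = λ { here → zero ; (there p) → suc (E.index p) }
  ; incl∈ = λ { zero → here ; (suc i) → there (E.incl∈ i) }
  ; index-incl = λ { zero here → refl ; (suc i) (there p) → cong suc (E.index-incl i p) }
  ; incl-index = λ { here → refl ; (there p) → cong suc (E.incl-index p) } }
  where
  module E = Enumeration (enumerate S)
  incl′ : Fin (suc ∣ S ∣) → Fin (suc m)
  incl′ zero    = zero
  incl′ (suc i) = suc (E.incl i)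

abstract
  retract : ∀ {m} {S : Subset m} {h} → h ∈ S → Retract S h
  retract {m} {S} {h} h∈S = record
    { incl = E.incl ; retr = retr ; incl∈ = E.incl∈
    ; retr-incl = retr-incl ; incl-retr = incl-retr
    ; retr-out = λ v∉S → trans (retr-out′ v∉S) (sym retr-h) }
    where
    module E = Enumeration (enumerate S)
    retr : Fin m → Fin ∣ S ∣
    retr v with v ∈? S
    ... | yes v∈S = E.index v∈S
    ... | no  _   = E.index h∈S
    retr-incl : ∀ i → retr (E.incl i) ≡ i
    retr-incl i with E.incl i ∈? S
    ... | yes p  = E.index-incl i p
    ... | no  ¬p = contradiction (E.incl∈ i) ¬p
    incl-retr : ∀ {v} → v ∈ S → E.incl (retr v) ≡ v
    incl-retr {v} v∈S with v ∈? S
    ... | yes p  = E.incl-index p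
    ... | no  ¬p = contradiction v∈S ¬p
    retr-out′ : ∀ {v} → v ∉ S → retr v ≡ E.index h∈S
    retr-out′ {v} v∉S with v ∈? S
    ... | yes p = contradiction p v∉S
    ... | no  _ = refl
    retr-h : retr h ≡ E.index h∈S
    retr-h = trans (sym (cong retr (E.incl-index h∈S))) (retr-incl (E.index h∈S))

-- Closure and circuits in a matroid.

module _ {n : ℕ} (M : Matroid n) where

  r-subadd : ∀ X Y → r M (X ∪ Y) ≤ r M X + r M Y
  r-subadd X Y = m+n≤o⇒m≤o _ (r-submod M X Y)

  rM≤r+r∁ : ∀ X → rM M ≤ r M X + r M (∁ X)
  rM≤r+r∁ X = subst (λ Z → r M Z ≤ r M X + r M (∁ X)) (p∪∁p≡⊤ X) (r-subadd X (∁ X))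

  ∈cl⁺ : ∀ {X e} → r M (X ∪ ⁅ e ⁆) ≡ r M X → e ∈ cl M X
  ∈cl⁺ = ∈-separate⁺ _

  ∈cl⁻ : ∀ {X e} → e ∈ cl M X → r M (X ∪ ⁅ e ⁆) ≡ r M X
  ∈cl⁻ {X} = ∈-separate⁻ (λ e → r M (X ∪ ⁅ e ⁆) ≟ⁿ r M X)

  -- Submodularity for `Y` and `X ∪ ⁅ e ⁆`: the union contains `Y ∪ ⁅ e ⁆` and the intersection
  -- contains `X`, so `r M X` cancels.
  cl-mono : ∀ {X Y} → X ⊆ Y → cl M X ⊆ cl M Y
  cl-mono {X} {Y} X⊆Y {e} e∈ = ∈cl⁺ (≤-antisym
    (+-cancelʳ-≤ (r M X) _ _ (begin
      r M (Y ∪ ⁅ e ⁆) + r M X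
        ≤⟨ +-mono-≤ (r-mono M _ _ Y∪e⊆) (r-mono M _ _ λ i → x∈p∩q⁺ (X⊆Y i , p⊆p∪q _ i)) ⟩
      r M (Y ∪ (X ∪ ⁅ e ⁆)) + r M (Y ∩ (X ∪ ⁅ e ⁆))
        ≤⟨ r-submod M Y (X ∪ ⁅ e ⁆) ⟩
      r M Y + r M (X ∪ ⁅ e ⁆)
        ≡⟨ cong (r M Y +_) (∈cl⁻ e∈) ⟩
      r M Y + r M X ∎))
    (r-mono M _ _ (p⊆p∪q _)))
    where
    open ≤-Reasoning
    Y∪e⊆ : Y ∪ ⁅ e ⁆ ⊆ Y ∪ (X ∪ ⁅ e ⁆)
    Y∪e⊆ i = x∈p∪q⁺ ([ inj₁ , (λ i∈e → inj₂ (q⊆p∪q X _ i∈e)) ]′ (x∈p∪q⁻ Y ⁅ e ⁆ i))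

  ∉cl⇒r< : ∀ {X e} → e ∉ cl M X → r M X < r M (X ∪ ⁅ e ⁆)
  ∉cl⇒r< {X} {e} e∉ =
    ≤∧≢⇒< (r-mono M _ _ (p⊆p∪q _)) (λ eq → e∉ (∈cl⁺ (sym eq)))

  independent? : ∀ X → Dec (Independent M X)
  independent? X = r M X ≟ⁿ ∣ X ∣

  dependent⇒r< : ∀ {X} → ¬ Independent M X → r M X < ∣ X ∣
  dependent⇒r< {X} ¬ind = ≤∧≢⇒< (r-bound M X) ¬ind

  -- Descend through dependent proper subsets until none is left.
  dependent⇒circuit : ∀ {X} → ¬ Independent M X → ∃[ C ] IsCircuit M C
  dependent⇒circuit {X} = go X (⊂-wellFounded X)
    where
    go : ∀ X → Acc _⊂_ X → ¬ Independent M X → ∃[ C ] IsCircuit M C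
    go X (acc rs) dep with anySubset? (λ D → (D ⊂? X) ×-dec ¬? (independent? D))
    ... | yes (D , D⊂X , depD) = go D (rs D⊂X) depD
    ... | no  ¬∃ = X , dep , minimal
      where
      minimal : ∀ D → D ⊂ X → Independent M D
      minimal D D⊂X with independent? D
      ... | yes ind = ind
      ... | no  ¬i  = contradiction (D , D⊂X , ¬i) ¬∃

-- Circuits of a 3-connected matroid of rank at least two.

module _ {n : ℕ} (M : Matroid n) (3-connected : ThreeConnected M) (2≤rM : 2 ≤ rM M) where

  open ≤-Reasoning

  rM<r+r∁ : ∀ {X} → 1 ≤ ∣ X ∣ → 1 ≤ ∣ ∁ X ∣ → rM M < r M X + r M (∁ X)
  rM<r+r∁ {X} 1≤x 1≤y = ≰⇒> λ le →
    3-connected 1 (s≤s (s≤s z≤n)) X (1≤x , 1≤y , subst (r M X + r M (∁ X) <_) (+-comm 1 (rM M)) (s≤s le))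

  -- Such a `C` has rank at most 1, hence `r M C + r M (∁ C) < rM M + 2`. The absence of
  -- 1-separations forces rank exactly 1 and, as `2 ≤ rM M`, at least two elements outside `C`; so
  -- `C` is a 2-separation.
  no-small-circuit : ∀ {C} → IsCircuit M C → ¬ ∣ C ∣ ≤ 2
  no-small-circuit {C} (dep , _) c≤2 =
    3-connected 2 (s≤s (s≤s (s≤s z≤n))) C (≤-trans (s≤s 1≤rC) rC<c , 2≤∁ , (begin-strict
      r M C + r M (∁ C)     ≤⟨ +-mono-≤ rC≤1 (r-mono M _ _ ⊆⊤) ⟩
      1 + rM M              <⟨ ≤-refl ⟩
      2 + rM M              ≡⟨ +-comm 2 (rM M) ⟩
      rM M + 2              ∎))
    where
    rC<c : r M C < ∣ C ∣
    rC<c = dependent⇒r< M dep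
    rC≤1 : r M C ≤ 1
    rC≤1 = s≤s⁻¹ (≤-trans rC<c c≤2)
    1≤∁ : 1 ≤ ∣ ∁ C ∣
    1≤∁ = +-cancelˡ-≤ 1 _ _ (begin
      2                      ≤⟨ 2≤rM ⟩
      rM M                   ≤⟨ rM≤r+r∁ M C ⟩
      r M C + r M (∁ C)      ≤⟨ +-mono-≤ rC≤1 (r-bound M (∁ C)) ⟩
      1 + ∣ ∁ C ∣            ∎)
    connected : rM M < r M C + r M (∁ C)
    connected = rM<r+r∁ (≤-trans (s≤s z≤n) rC<c) 1≤∁
    1≤rC : 1 ≤ r M C
    1≤rC = +-cancelʳ-≤ (rM M) _ _ (≤-trans connected (+-monoʳ-≤ (r M C) (r-mono M _ _ ⊆⊤)))
    2≤∁ : 2 ≤ ∣ ∁ C ∣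
    2≤∁ = s≤s⁻¹ (begin
      3                      ≤⟨ s≤s 2≤rM ⟩
      suc (rM M)             ≤⟨ connected ⟩
      r M C + r M (∁ C)      ≤⟨ +-mono-≤ rC≤1 (r-bound M (∁ C)) ⟩
      1 + ∣ ∁ C ∣            ∎)

  -- If the ground set were independent, its rank `n` would equal the sum of the sizes of `⁅ e ⁆`
  -- and its complement, making `⁅ e ⁆` a 1-separation.
  circuit-exists : ∃[ C ] IsCircuit M C
  circuit-exists = dependent⇒circuit M {⊤} λ ind →
    n≮n n (begin-strict
      n                      ≡⟨ sym (∣⊤∣≡n n) ⟩
      ∣ ⊤ {n} ∣              ≡⟨ sym ind ⟩
      rM M                   <⟨ rM<r+r∁ {⁅ e ⁆} (≤-reflexive (sym (∣⁅x⁆∣≡1 e))) 1≤∁ ⟩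
      r M ⁅ e ⁆ + r M (∁ ⁅ e ⁆)   ≤⟨ +-mono-≤ (r-bound M _) (r-bound M _) ⟩
      ∣ ⁅ e ⁆ ∣ + ∣ ∁ ⁅ e ⁆ ∣     ≡⟨ ∣p∣+∣∁p∣≡n ⁅ e ⁆ ⟩
      n                      ∎)
    where
    2≤n : 2 ≤ n
    2≤n = ≤-trans 2≤rM (≤-trans (r-bound M ⊤) (≤-reflexive (∣⊤∣≡n n)))
    e : Fin n
    e = fromℕ< (<⇒≤ 2≤n)
    1≤∁ : 1 ≤ ∣ ∁ ⁅ e ⁆ ∣
    1≤∁ = +-cancelˡ-≤ 1 _ _ (begin
      2                           ≤⟨ 2≤n ⟩
      n                           ≡⟨ sym (∣p∣+∣∁p∣≡n ⁅ e ⁆) ⟩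
      ∣ ⁅ e ⁆ ∣ + ∣ ∁ ⁅ e ⁆ ∣     ≡⟨ cong (_+ ∣ ∁ ⁅ e ⁆ ∣) (∣⁅x⁆∣≡1 e) ⟩
      1 + ∣ ∁ ⁅ e ⁆ ∣             ∎)

-- Edges, induced subgraphs and reachability.

neither⁺ : ∀ {P Q : Set} (p? : Dec P) (q? : Dec Q) → ¬ P → ¬ Q →
  not (isYes p?) ∧ not (isYes q?) ≡ true
neither⁺ (yes p) _       ¬p ¬q = contradiction p ¬p
neither⁺ (no _)  (yes q) ¬p ¬q = contradiction q ¬q
neither⁺ (no _)  (no _)  ¬p ¬q = refl

neither⁻ : ∀ {P Q : Set} (p? : Dec P) (q? : Dec Q) →
  not (isYes p?) ∧ not (isYes q?) ≡ true → ¬ P × ¬ Q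
neither⁻ (no ¬p) (no ¬q) _ = ¬p , ¬q

both⁺ : ∀ {P Q : Set} (p? : Dec P) (q? : Dec Q) → P → Q → isYes p? ∧ isYes q? ≡ true
both⁺ (no ¬p) _       p q = contradiction p ¬p
both⁺ (yes _) (no ¬q) p q = contradiction q ¬q
both⁺ (yes _) (yes _) p q = refl

both⁻ : ∀ {P Q : Set} (p? : Dec P) (q? : Dec Q) → isYes p? ∧ isYes q? ≡ true → P × Q
both⁻ (yes p) (yes q) _ = p , q

module _ {n m : ℕ} (G : Graph n m) where

  private
    src tgt : Fin n → Fin m
    src e = proj₁ (ends G e)
    tgt e = proj₂ (ends G e)

  -- Forgets the orientation in which `ends` stores an edge, so that `fwd` and `bwd` steps are
  -- treated alike.
  Joins : Fin n → Fin m → Fin m → Set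
  Joins e u v = (ends G e ≡ (u , v)) ⊎ (ends G e ≡ (v , u))

  joins-sym : ∀ {e u v} → Joins e u v → Joins e v u
  joins-sym = [ inj₂ , inj₁ ]′

  isEnd⇒joins : ∀ {w e} → IsEnd G w e → ∃[ v ] Joins e w v
  isEnd⇒joins {w} {e} (inj₁ refl) = tgt e , inj₁ refl
  isEnd⇒joins {w} {e} (inj₂ refl) = src e , inj₂ refl

  joins⇒isEnd : ∀ {e u v} → Joins e u v → IsEnd G u e
  joins⇒isEnd (inj₁ eq) = inj₁ (cong proj₁ eq)
  joins⇒isEnd (inj₂ eq) = inj₂ (cong proj₂ eq)

  ∈edgesDel⁺ : ∀ {v e} → src e ≢ v → tgt e ≢ v → e ∈ edgesDel G v
  ∈edgesDel⁺ {v} {e} s≢ t≢ = lookup⇒[]= e _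
    (trans (lookup∘tabulate _ e) (neither⁺ (src e ≟ v) (tgt e ≟ v) s≢ t≢))

  ∈edgesDel⁻ : ∀ {v e} → e ∈ edgesDel G v → src e ≢ v × tgt e ≢ v
  ∈edgesDel⁻ {v} {e} e∈ = neither⁻ (src e ≟ v) (tgt e ≟ v)
    (trans (sym (lookup∘tabulate _ e)) ([]=⇒lookup e∈))

  ∈loopsAt⁺ : ∀ {v e} → src e ≡ v → tgt e ≡ v → e ∈ loopsAt G v
  ∈loopsAt⁺ {v} {e} s≡ t≡ = lookup⇒[]= e _
    (trans (lookup∘tabulate _ e) (both⁺ (src e ≟ v) (tgt e ≟ v) s≡ t≡))

  ∈loopsAt⁻ : ∀ {v e} → e ∈ loopsAt G v → src e ≡ v × tgt e ≡ v
  ∈loopsAt⁻ {v} {e} e∈ = both⁻ (src e ≟ v) (tgt e ≟ v)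
    (trans (sym (lookup∘tabulate _ e)) ([]=⇒lookup e∈))

  inside? : ∀ (U : Subset m) e → Dec (src e ∈ U × tgt e ∈ U)
  inside? U e = (src e ∈? U) ×-dec (tgt e ∈? U)

  abstract
    induced : Subset m → Subset n
    induced U = separate (inside? U)

    ∈induced⁺ : ∀ {U e u v} → Joins e u v → u ∈ U → v ∈ U → e ∈ induced U
    ∈induced⁺ {U} (inj₁ refl) u∈ v∈ = ∈-separate⁺ (inside? U) (u∈ , v∈)
    ∈induced⁺ {U} (inj₂ refl) u∈ v∈ = ∈-separate⁺ (inside? U) (v∈ , u∈)

    ∈induced⁻ : ∀ {U e u v} → Joins e u v → e ∈ induced U → u ∈ U × v ∈ U
    ∈induced⁻ {U} (inj₁ refl) e∈ = ∈-separate⁻ (inside? U) e∈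
    ∈induced⁻ {U} (inj₂ refl) e∈ with ∈-separate⁻ (inside? U) e∈
    ... | v∈ , u∈ = u∈ , v∈

  induced-mono : ∀ {U W} → U ⊆ W → induced U ⊆ induced W
  induced-mono U⊆W {e} e∈ with ∈induced⁻ (inj₁ refl) e∈
  ... | u∈ , v∈ = ∈induced⁺ (inj₁ refl) (U⊆W u∈) (U⊆W v∈)

  reach-step : ∀ {X a e u v} → Reach G X a u → e ∈ X → Joins e u v → Reach G X a v
  reach-step {e = e} p e∈ (inj₁ refl) = fwd e e∈ p
  reach-step {e = e} p e∈ (inj₂ refl) = bwd e e∈ p

  reach-ind : ∀ {X a} (P : Fin m → Set) → P a →
    (∀ {e u v} → e ∈ X → Joins e u v → Reach G X a u → P u → P v) →
    ∀ {w} → Reach G X a w → P w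
  reach-ind P base step here         = base
  reach-ind P base step (fwd e e∈ p) = step e∈ (inj₁ refl) p (reach-ind P base step p)
  reach-ind P base step (bwd e e∈ p) = step e∈ (inj₂ refl) p (reach-ind P base step p)

  reach-trans : ∀ {X a u w} → Reach G X a u → Reach G X u w → Reach G X a w
  reach-trans {X} {a} p = reach-ind (Reach G X a) p (λ e∈ j _ q → reach-step q e∈ j)

  reach-sym : ∀ {X a w} → Reach G X a w → Reach G X w a
  reach-sym {X} {a} = reach-ind (λ w → Reach G X w a) here
    (λ e∈ j _ q → reach-trans (reach-step here e∈ (joins-sym j)) q)

  reach-mono : ∀ {X Y a w} → X ⊆ Y → Reach G X a w → Reach G Y a w
  reach-mono {Y = Y} {a} X⊆Y = reach-ind (Reach G Y a) here (λ e∈ j _ q → reach-step q (X⊆Y e∈) j)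

  Crossing : Subset n → Subset m → Set
  Crossing X U = ∃[ e ] ∃[ u ] ∃[ v ] (e ∈ X × Joins e u v × u ∈ U × v ∉ U)

  crossing? : ∀ X U → Dec (Crossing X U)
  crossing? X U with any? (λ e → (e ∈? X) ×-dec
    (((src e ∈? U) ×-dec ¬? (tgt e ∈? U)) ⊎-dec ((tgt e ∈? U) ×-dec ¬? (src e ∈? U))))
  ... | yes (e , e∈ , inj₁ (u∈ , v∉)) = yes (e , _ , _ , e∈ , inj₁ refl , u∈ , v∉)
  ... | yes (e , e∈ , inj₂ (u∈ , v∉)) = yes (e , _ , _ , e∈ , inj₂ refl , u∈ , v∉)
  ... | no ¬∃ = no λ
    { (e , u , v , e∈ , inj₁ refl , u∈ , v∉) → ¬∃ (e , e∈ , inj₁ (u∈ , v∉))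
    ; (e , u , v , e∈ , inj₂ refl , u∈ , v∉) → ¬∃ (e , e∈ , inj₂ (u∈ , v∉)) }

  ¬crossing⇒closed : ∀ {X U a} → ¬ Crossing X U → a ∈ U → ∀ {w} → Reach G X a w → w ∈ U
  ¬crossing⇒closed {U = U} ¬cr a∈ = reach-ind (_∈ U) a∈ step
    where
    step : ∀ {e u v} → e ∈ _ → Joins e u v → _ → u ∈ U → v ∈ U
    step {v = v} e∈ j _ u∈ with v ∈? U
    ... | yes v∈ = v∈
    ... | no  v∉ = contradiction (_ , _ , _ , e∈ , j , u∈ , v∉) ¬cr

  -- A set that no edge of `X` leaves is closed under walks in `X`.
  reach⇒crossing : ∀ {X U a w} → Reach G X a w → a ∈ U → w ∉ U → Crossing X U
  reach⇒crossing {X} {U} p a∈ w∉ with crossing? X U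
  ... | yes cr = cr
  ... | no ¬cr = contradiction (¬crossing⇒closed ¬cr a∈ p) w∉

  ⊂-∪⁅⁆ : ∀ {U : Subset m} {v} → v ∉ U → U ⊂ U ∪ ⁅ v ⁆
  ⊂-∪⁅⁆ {U} {v} v∉ = p⊆p∪q _ , v , q⊆p∪q U _ (x∈⁅x⁆ v) , v∉

  -- Start from `⁅ a ⁆` and absorb the outer end of a crossing edge while there is one; the set
  -- grows strictly, so this stops.
  reachable : ∀ X a → ∃[ S ] (∀ w → (w ∈ S → Reach G X a w) × (Reach G X a w → w ∈ S))
  reachable X a = grow ⁅ a ⁆ (⊃-wellFounded ⁅ a ⁆) (x∈⁅x⁆ a)
    (λ w∈ → subst (Reach G X a) (sym (x∈⁅y⁆⇒x≡y a w∈)) here)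
    where
    grow : ∀ U → Acc (λ p q → q ⊂ p) U → a ∈ U → (∀ {w} → w ∈ U → Reach G X a w) →
           ∃[ S ] (∀ w → (w ∈ S → Reach G X a w) × (Reach G X a w → w ∈ S))
    grow U (acc rs) a∈ sound with crossing? X U
    ... | no ¬cr = U , λ w → sound , ¬crossing⇒closed ¬cr a∈
    ... | yes (e , u , v , e∈ , j , u∈ , v∉) =
      grow (U ∪ ⁅ v ⁆) (rs (⊂-∪⁅⁆ v∉)) (p⊆p∪q _ a∈) λ w∈ →
        [ sound
        , (λ w∈v → subst (Reach G X a) (sym (x∈⁅y⁆⇒x≡y v w∈v)) (reach-step (sound u∈) e∈ j))
        ]′ (x∈p∪q⁻ U ⁅ v ⁆ w∈)

  abstract
    reachSet : Subset n → Fin m → Subset m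
    reachSet X a = proj₁ (reachable X a)

    ∈reachSet⁺ : ∀ {X a w} → Reach G X a w → w ∈ reachSet X a
    ∈reachSet⁺ {X} {a} {w} = proj₂ (proj₂ (reachable X a) w)

    ∈reachSet⁻ : ∀ {X a w} → w ∈ reachSet X a → Reach G X a w
    ∈reachSet⁻ {X} {a} {w} = proj₁ (proj₂ (reachable X a) w)

  reachSet-step : ∀ {X a e u v} → e ∈ X → Joins e u v → u ∈ reachSet X a → v ∈ reachSet X a
  reachSet-step e∈ j u∈ = ∈reachSet⁺ (reach-step (∈reachSet⁻ u∈) e∈ j)

  -- Every vertex along the walk is itself reachable, so each edge used has both ends in the reach
  -- set.
  reach⇒reach-induced : ∀ {X a w} → Reach G X a w → Reach G (induced (reachSet X a)) a w
  reach⇒reach-induced {X} {a} = reach-ind (Reach G _ a) here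
    (λ e∈ j p q → reach-step q (∈induced⁺ j (∈reachSet⁺ p) (∈reachSet⁺ (reach-step p e∈ j))) j)

  ∉induced-reachSet⇒∉ : ∀ {X a e u v} → e ∈ X → Joins e u v →
    e ∉ induced (reachSet X a) → u ∉ reachSet X a
  ∉induced-reachSet⇒∉ e∈ j e∉ u∈ = e∉ (∈induced⁺ j u∈ (reachSet-step e∈ j u∈))

-- Rank inequalities from condition (iv).

module _ {n m : ℕ} (M : Matroid n) (G : Graph n m)
  (closed : ∀ v → cl M (edgesDel G v) ⊆ (edgesDel G v ∪ loopsAt G v)) where

  -- The edge `e` meets `v` and is not a loop, so (iv) keeps it out of the closure of
  -- `edgesDel G v`, and hence out of that of `Z`.
  r-new-vertex : ∀ {Z e u v} → Z ⊆ edgesDel G v → Joins G e u v → u ≢ v →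
    r M Z < r M (Z ∪ ⁅ e ⁆)
  r-new-vertex {Z} {e} {u} {v} Z⊆ j u≢v =
    ∉cl⇒r< M λ e∈ → [ ∉del j , ∉loop j ]′ (x∈p∪q⁻ _ _ (closed v (cl-mono M Z⊆ e∈)))
    where
    ∉del : Joins G e u v → e ∉ edgesDel G v
    ∉del (inj₁ refl) e∈ = proj₂ (∈edgesDel⁻ G e∈) refl
    ∉del (inj₂ refl) e∈ = proj₁ (∈edgesDel⁻ G e∈) refl
    ∉loop : Joins G e u v → e ∉ loopsAt G v
    ∉loop (inj₁ refl) e∈ = u≢v (proj₁ (∈loopsAt⁻ G e∈))
    ∉loop (inj₂ refl) e∈ = u≢v (proj₂ (∈loopsAt⁻ G e∈))

  -- The deletions run in reverse: outside vertices are added to `U` one by one, each through an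
  -- edge of `Y` that raises the rank by `r-new-vertex`.
  r-growth : ∀ Y U → (∀ v → v ∉ U → ∃[ u ] (u ∈ U × Reach G Y u v)) →
    r M (Y ∩ induced G U) + ∣ ∁ U ∣ ≤ r M Y
  r-growth Y U = go U (⊃-wellFounded U)
    where
    open ≤-Reasoning
    go : ∀ U → Acc (λ p q → q ⊂ p) U → (∀ v → v ∉ U → ∃[ u ] (u ∈ U × Reach G Y u v)) →
      r M (Y ∩ induced G U) + ∣ ∁ U ∣ ≤ r M Y
    go U (acc rs) near with nonempty? (∁ U)
    ... | no empty = begin
      r M (Y ∩ induced G U) + ∣ ∁ U ∣   ≡⟨ cong (λ p → r M (Y ∩ induced G U) + ∣ p ∣) (Empty-unique empty) ⟩
      r M (Y ∩ induced G U) + ∣ ⊥ {m} ∣ ≡⟨ cong (r M (Y ∩ induced G U) +_) (∣⊥∣≡0 m) ⟩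
      r M (Y ∩ induced G U) + 0         ≡⟨ +-identityʳ _ ⟩
      r M (Y ∩ induced G U)             ≤⟨ r-mono M _ _ (p∩q⊆p Y _) ⟩
      r M Y                             ∎
    ... | yes (x , x∈) with near x (x∈∁p⇒x∉p x∈)
    -- The next vertex added is the outer end `v` of the edge where the walk to `x` leaves `U`; it
    -- need not be `x`.
    ... | a , a∈ , p with reach⇒crossing G p a∈ (x∈∁p⇒x∉p x∈)
    ... | e , u , v , e∈ , j , u∈ , v∉ = begin
      r M Z + ∣ ∁ U ∣                         ≤⟨ +-monoʳ-≤ (r M Z) ∣∁U∣≤ ⟩
      r M Z + suc ∣ ∁ U′ ∣                    ≡⟨ +-suc _ _ ⟩
      suc (r M Z) + ∣ ∁ U′ ∣                  ≤⟨ +-monoˡ-≤ _ (r-new-vertex Z⊆ j u≢v) ⟩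
      r M (Z ∪ ⁅ e ⁆) + ∣ ∁ U′ ∣              ≤⟨ +-monoˡ-≤ _ (r-mono M _ _ Z∪e⊆) ⟩
      r M (Y ∩ induced G U′) + ∣ ∁ U′ ∣       ≤⟨ go U′ (rs (⊂-∪⁅⁆ G v∉)) near′ ⟩
      r M Y                                   ∎
      where
      U′ = U ∪ ⁅ v ⁆
      Z = Y ∩ induced G U
      U⊆U′ : U ⊆ U′
      U⊆U′ = p⊆p∪q _
      u≢v : u ≢ v
      u≢v refl = v∉ u∈
      ∣∁U∣≤ : ∣ ∁ U ∣ ≤ suc ∣ ∁ U′ ∣
      ∣∁U∣≤ = ≤-trans (∣p∣≤1+∣p∩∁⁅x⁆∣ (∁ U) v) (s≤s (p⊆q⇒∣p∣≤∣q∣ λ {w} w∈ →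
        let w∈∁U , w∈∁v = x∈p∩q⁻ (∁ U) _ w∈ in
        x∉p⇒x∈∁p λ w∈U′ → [ x∈∁p⇒x∉p w∈∁U , x∈∁p⇒x∉p w∈∁v ]′ (x∈p∪q⁻ U _ w∈U′)))
      Z⊆ : Z ⊆ edgesDel G v
      Z⊆ {f} f∈ with ∈induced⁻ G (inj₁ refl) (proj₂ (x∈p∩q⁻ Y _ f∈))
      ... | s∈ , t∈ = ∈edgesDel⁺ G (λ { refl → v∉ s∈ }) (λ { refl → v∉ t∈ })
      Z∪e⊆ : Z ∪ ⁅ e ⁆ ⊆ Y ∩ induced G U′
      Z∪e⊆ {f} f∈ with x∈p∪q⁻ Z ⁅ e ⁆ f∈
      ... | inj₁ f∈Z with x∈p∩q⁻ Y _ f∈Z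
      ...   | f∈Y , f∈U = x∈p∩q⁺ (f∈Y , induced-mono G U⊆U′ f∈U)
      Z∪e⊆ {f} f∈ | inj₂ f∈e rewrite x∈⁅y⁆⇒x≡y e f∈e =
        x∈p∩q⁺ (e∈ , ∈induced⁺ G j (U⊆U′ u∈) (q⊆p∪q U _ (x∈⁅x⁆ v)))
      near′ : ∀ w → w ∉ U′ → ∃[ b ] (b ∈ U′ × Reach G Y b w)
      near′ w w∉ with near w (λ w∈ → w∉ (U⊆U′ w∈))
      ... | b , b∈ , q = b , U⊆U′ b∈ , q

  -- Apply `r-growth` with everything outside the component, together with `h`, as `U`: the rest of
  -- the component is reached from `h`. Keeping `h` accounts for the `suc`.
  r-outside-component : ∀ Y h →
    r M (Y ∩ ∁ (induced G (reachSet G Y h))) + ∣ reachSet G Y h ∣ ≤ suc (r M Y)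
  r-outside-component Y h = begin
    r M (Y ∩ ∁ (induced G S)) + ∣ S ∣       ≤⟨ +-mono-≤ (r-mono M _ _ outside⊆) ∣S∣≤ ⟩
    r M (Y ∩ induced G U) + suc ∣ ∁ U ∣     ≡⟨ +-suc _ _ ⟩
    suc (r M (Y ∩ induced G U) + ∣ ∁ U ∣)   ≤⟨ s≤s (r-growth Y U near) ⟩
    suc (r M Y)                             ∎
    where
    open ≤-Reasoning
    S = reachSet G Y h
    U = ∁ S ∪ ⁅ h ⁆
    ∣S∣≤ : ∣ S ∣ ≤ suc ∣ ∁ U ∣
    ∣S∣≤ = ≤-trans (∣p∣≤1+∣p∩∁⁅x⁆∣ S h) (s≤s (p⊆q⇒∣p∣≤∣q∣ λ w∈ →
      let w∈S , w∈∁h = x∈p∩q⁻ S _ w∈ in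
      x∉p⇒x∈∁p λ w∈U →
        [ (λ w∈∁S → x∈∁p⇒x∉p w∈∁S w∈S) , x∈∁p⇒x∉p w∈∁h ]′ (x∈p∪q⁻ (∁ S) _ w∈U)))
    outside⊆ : Y ∩ ∁ (induced G S) ⊆ Y ∩ induced G U
    outside⊆ {e} e∈ with x∈p∩q⁻ Y _ e∈
    ... | e∈Y , e∈∁ = x∈p∩q⁺ (e∈Y , ∈induced⁺ G {u = proj₁ (ends G e)} (inj₁ refl)
      (p⊆p∪q _ (x∉p⇒x∈∁p (∉induced-reachSet⇒∉ G e∈Y (inj₁ refl) (x∈∁p⇒x∉p e∈∁))))
      (p⊆p∪q _ (x∉p⇒x∈∁p (∉induced-reachSet⇒∉ G e∈Y (inj₂ refl) (x∈∁p⇒x∉p e∈∁)))))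
    near : ∀ v → v ∉ U → ∃[ u ] (u ∈ U × Reach G Y u v)
    near v v∉ with v ∈? S
    ... | yes v∈S = h , q⊆p∪q (∁ S) _ (x∈⁅x⁆ h) , ∈reachSet⁻ G v∈S
    ... | no  v∉S = contradiction (p⊆p∪q _ (x∉p⇒x∈∁p v∉S)) v∉

  -- Apply `r-growth` to all edges and cancel `∣ ∁ U ∣` from `m`; the vertex `a` makes `U` nonempty,
  -- so that it reaches everything.
  r-induced≤ : Connected G → rM M ≤ m → ∀ {U a} → a ∈ U → r M (induced G U) ≤ ∣ U ∣
  r-induced≤ conn rM≤m {U} {a} a∈ = +-cancelʳ-≤ ∣ ∁ U ∣ _ _ (begin
    r M (induced G U) + ∣ ∁ U ∣       ≤⟨ +-monoˡ-≤ _ (r-mono M _ _ λ i → x∈p∩q⁺ (∈⊤ , i)) ⟩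
    r M (⊤ ∩ induced G U) + ∣ ∁ U ∣   ≤⟨ r-growth ⊤ U (λ v _ → a , a∈ , conn a v) ⟩
    rM M                              ≤⟨ rM≤m ⟩
    m                                 ≡⟨ sym (∣p∣+∣∁p∣≡n U) ⟩
    ∣ U ∣ + ∣ ∁ U ∣                   ∎)
    where open ≤-Reasoning

  -- Removing the component of `a` removes `e`, so the remainder of `C` is independent and its size
  -- is its rank. `r-outside-component` bounds that rank, and its `suc` is absorbed by
  -- `r M C < ∣ C ∣`.
  circuit-component-size : ∀ {C} → IsCircuit M C → ∀ {a e} → e ∈ C → IsEnd G a e →
    ∣ reachSet G C a ∣ ≤ ∣ C ∩ induced G (reachSet G C a) ∣
  circuit-component-size {C} (dep , min) {a} {e} e∈ a-end =
    +-cancelˡ-≤ ∣ C ∩ ∁ I ∣ _ _ (begin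
      ∣ C ∩ ∁ I ∣ + ∣ S ∣       ≡⟨ cong (_+ ∣ S ∣) (sym (min _ (p∩q⊆p C _ , e , e∈ , e∉))) ⟩
      r M (C ∩ ∁ I) + ∣ S ∣     ≤⟨ r-outside-component C a ⟩
      suc (r M C)               ≤⟨ dependent⇒r< M dep ⟩
      ∣ C ∣                     ≡⟨ ∣p∣≡∣p∩q∣+∣p∩∁q∣ C I ⟩
      ∣ C ∩ I ∣ + ∣ C ∩ ∁ I ∣   ≡⟨ +-comm ∣ C ∩ I ∣ _ ⟩
      ∣ C ∩ ∁ I ∣ + ∣ C ∩ I ∣   ∎)
    where
    open ≤-Reasoning
    S = reachSet G C a
    I = induced G S
    e∉ : e ∉ C ∩ ∁ I
    e∉ e∈′ with isEnd⇒joins G a-end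
    ... | v , j = ∉induced-reachSet⇒∉ G e∈ j
      (x∈∁p⇒x∉p (proj₂ (x∈p∩q⁻ C _ e∈′))) (∈reachSet⁺ G here)

  -- From a connected graph to a framework.

  circuit-at-most-two-components : Connected G → rM M ≤ m →
    ∀ C → IsCircuit M C → AtMostTwoComponents G C
  circuit-at-most-two-components conn rM≤m C circ@(dep , min) = conclusion
    where
    open ≤-Reasoning
    src tgt : Fin n → Fin m
    src e = proj₁ (ends G e)
    tgt e = proj₂ (ends G e)

    C-nonempty : ∃[ e ] e ∈ C
    C-nonempty with nonempty? C
    ... | yes ne = ne
    ... | no empty = contradiction (≤-antisym (r-bound M C)
      (subst (_≤ r M C) (sym (trans (cong ∣_∣ (Empty-unique empty)) (∣⊥∣≡0 n))) z≤n)) dep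

    e₀ = proj₁ C-nonempty
    e₀∈ = proj₂ C-nonempty
    a = src e₀
    V₁ = reachSet G C a

    other? : ∀ w → Dec (w ∉ V₁ × ∃[ e ] (e ∈ C × IsEnd G w e))
    other? w = ¬? (w ∈? V₁) ×-dec
      any? (λ e → (e ∈? C) ×-dec ((src e ≟ w) ⊎-dec (tgt e ≟ w)))

    -- `K` collects the vertices of all components of `G[C]` other than `V₁`, and `R` is what `a`
    -- reaches in `G` while avoiding `K`.
    K = separate other?
    F = induced G (∁ K)
    R = reachSet G F a

    a∉K : a ∉ K
    a∉K a∈K = proj₁ (∈-separate⁻ other? a∈K) (∈reachSet⁺ G here)

    R∩K=∅ : ∀ {w} → w ∈ R → w ∉ K
    R∩K=∅ w∈ = reach-ind G (_∉ K) a∉K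
      (λ e∈ j _ _ → x∈∁p⇒x∉p (proj₂ (∈induced⁻ G j e∈))) (∈reachSet⁻ G w∈)

    V₁∩K=∅ : ∀ {w} → w ∈ V₁ → w ∉ K
    V₁∩K=∅ w∈ w∈K = proj₁ (∈-separate⁻ other? w∈K) w∈

    V₁⊆R : V₁ ⊆ R
    V₁⊆R w∈ = reach-ind G (_∈ R) (∈reachSet⁺ G here) (λ e∈ j p u∈ →
      reachSet-step G (∈induced⁺ G j
        (x∉p⇒x∈∁p (V₁∩K=∅ (∈reachSet⁺ G p)))
        (x∉p⇒x∈∁p (V₁∩K=∅ (∈reachSet⁺ G (reach-step G p e∈ j))))) j u∈) (∈reachSet⁻ G w∈)

    -- Otherwise the edge would avoid `K` and extend `R`. Hence an edge leaving `R` leads directly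
    -- into a second component of `G[C]`.
    leaves-R⇒K : ∀ {e u v} → Joins G e u v → u ∈ R → v ∉ R → v ∈ K
    leaves-R⇒K {v = v} j u∈ v∉ with v ∈? K
    ... | yes v∈K = v∈K
    ... | no  v∉K = contradiction
      (reachSet-step G (∈induced⁺ G j (x∉p⇒x∈∁p (R∩K=∅ u∈)) (x∉p⇒x∈∁p v∉K)) j u∈) v∉

    module _ {e u b} (j : Joins G e u b) (u∈R : u ∈ R) (b∉R : b ∉ R) where

      b∉V₁ : b ∉ V₁
      b∉V₁ b∈ = b∉R (V₁⊆R b∈)

      b-edge : ∃[ f ] (f ∈ C × IsEnd G b f)
      b-edge = proj₂ (∈-separate⁻ other? (leaves-R⇒K j u∈R b∉R))

      V₂ = reachSet G C b
      W = R ∪ V₂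

      R⊆W : R ⊆ W
      R⊆W = p⊆p∪q _
      V₂⊆W : V₂ ⊆ W
      V₂⊆W = q⊆p∪q R _

      -- `R` avoids `K`, so an end of an edge of `C` lying in `R` can only belong to `V₁`.
      W∩C : ∀ {f x y} → f ∈ C → Joins G f x y → x ∈ W → (x ∈ V₁ ⊎ x ∈ V₂)
      W∩C {f} {x} f∈ jf x∈ with x∈p∪q⁻ R V₂ x∈ | x ∈? V₁
      ... | inj₂ x∈V₂ | _         = inj₂ x∈V₂
      ... | inj₁ _    | yes x∈V₁ = inj₁ x∈V₁
      ... | inj₁ x∈R  | no x∉V₁  = contradiction
        (∈-separate⁺ other? (x∉V₁ , f , f∈ , joins⇒isEnd G jf)) (R∩K=∅ x∈R)

      W-step : ∀ {f x y} → f ∈ C → Joins G f x y → x ∈ W → y ∈ W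
      W-step f∈ jf x∈ with W∩C f∈ jf x∈
      ... | inj₁ x∈V₁ = R⊆W (V₁⊆R (reachSet-step G f∈ jf x∈V₁))
      ... | inj₂ x∈V₂ = V₂⊆W (reachSet-step G f∈ jf x∈V₂)

      I = induced G W

      within-R : ∀ {w} → w ∈ R → Reach G I a w
      within-R w∈ = reach-mono G (induced-mono G R⊆W) (reach⇒reach-induced G (∈reachSet⁻ G w∈))

      W-connected : ∀ {w} → w ∈ W → Reach G I a w
      W-connected w∈ with x∈p∪q⁻ R V₂ w∈
      ... | inj₁ w∈R = within-R w∈R
      ... | inj₂ w∈V₂ = reach-trans G
        (reach-step G (within-R u∈R) (∈induced⁺ G j (R⊆W u∈R) (V₂⊆W (∈reachSet⁺ G here))) j)
        (reach-mono G (induced-mono G V₂⊆W) (reach⇒reach-induced G (∈reachSet⁻ G w∈V₂)))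

      -- An edge `f` starting outside `W` would give `∣ W ∣ + ∣ C ∣ ≤ r M (I ∪ C) + ∣ C ∩ I ∣ < ∣ W
      -- ∣ + ∣ C ∣`, by `lower` and `upper`; the chain carries one more `∣ C ∩ I ∣` on both sides.
      no-third : ∀ {f} → f ∈ C → ¬ src f ∉ W
      no-third {f} f∈ s∉W = n≮n (#C∩I + #W + #C) (begin-strict
        #C∩I + #W + #C                    ≡⟨ cong (#C∩I + #W +_) (∣p∣≡∣p∩q∣+∣p∩∁q∣ C I) ⟩
        #C∩I + #W + (#C∩I + #D)           ≤⟨ +-monoˡ-≤ _ (+-monoʳ-≤ #C∩I ∣W∣≤) ⟩
        #C∩I + (#B + #∁U) + (#C∩I + #D)   ≡⟨ rearrange #C∩I #B #∁U #D ⟩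
        #B + #D + #∁U + #C∩I + #C∩I       ≤⟨ +-monoˡ-≤ _ (+-monoˡ-≤ _ lower) ⟩
        r M (I ∪ C) + #C∩I + #C∩I         <⟨ +-monoˡ-< #C∩I upper ⟩
        #W + #C + #C∩I                    ≡⟨ rotate #W #C #C∩I ⟩
        #C∩I + #W + #C                    ∎)
        where
        rearrange : ∀ i b u d → i + (b + u) + (i + d) ≡ b + d + u + i + i
        rearrange = solve-∀
        rotate : ∀ w c i → w + c + i ≡ i + w + c
        rotate = solve-∀

        -- `B` is the part of `C` on `V₁` and `D` the part off `W`, so `Z` is `C` without its edges
        -- on `V₂`. The complement of `U` is `W` without `V₁`.
        B = C ∩ induced G V₁
        D = C ∩ ∁ I
        Z = B ∪ D
        U = V₁ ∪ ∁ W

        #B = ∣ B ∣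
        #C = ∣ C ∣
        #D = ∣ D ∣
        #W = ∣ W ∣
        #∁U = ∣ ∁ U ∣
        #C∩I = ∣ C ∩ I ∣

        ∣W∣≤ : ∣ W ∣ ≤ ∣ B ∣ + ∣ ∁ U ∣
        ∣W∣≤ = begin
          ∣ W ∣                         ≡⟨ ∣p∣≡∣p∩q∣+∣p∩∁q∣ W V₁ ⟩
          ∣ W ∩ V₁ ∣ + ∣ W ∩ ∁ V₁ ∣     ≤⟨ +-mono-≤ (≤-trans (∣p∩q∣≤∣q∣ W V₁)
                                             (circuit-component-size circ e₀∈ (inj₁ refl)))
                                             (p⊆q⇒∣p∣≤∣q∣ W∖V₁⊆) ⟩
          ∣ B ∣ + ∣ ∁ U ∣               ∎
          where
          W∖V₁⊆ : W ∩ ∁ V₁ ⊆ ∁ U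
          W∖V₁⊆ w∈ with x∈p∩q⁻ W _ w∈
          ... | w∈W , w∈∁V₁ = x∉p⇒x∈∁p λ w∈U →
            [ x∈∁p⇒x∉p w∈∁V₁ , (λ w∈∁W → x∈∁p⇒x∉p w∈∁W w∈W) ]′ (x∈p∪q⁻ V₁ _ w∈U)

        B⊆I : induced G V₁ ⊆ I
        B⊆I = induced-mono G (λ w∈ → R⊆W (V₁⊆R w∈))

        ∣B∣+∣D∣≤ : ∣ B ∣ + ∣ D ∣ ≤ ∣ Z ∣
        ∣B∣+∣D∣≤ = begin
          ∣ B ∣ + ∣ D ∣                ≤⟨ +-mono-≤
            (p⊆q⇒∣p∣≤∣q∣ λ i → x∈p∩q⁺ (p⊆p∪q D i , B⊆I (proj₂ (x∈p∩q⁻ C _ i))))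
            (p⊆q⇒∣p∣≤∣q∣ λ i → x∈p∩q⁺ (q⊆p∪q B D i , proj₂ (x∈p∩q⁻ C _ i))) ⟩
          ∣ Z ∩ I ∣ + ∣ Z ∩ ∁ I ∣      ≡⟨ sym (∣p∣≡∣p∩q∣+∣p∩∁q∣ Z I) ⟩
          ∣ Z ∣                        ∎

        Z⊂C : Z ⊂ C
        Z⊂C with b-edge
        -- The edge `g` of `C` at `b` is missing from `Z`: `b` is not in `V₁`, and both ends of `g`
        -- lie in `W`.
        ... | g , g∈ , b-end with isEnd⇒joins G b-end
        ... | y , jg = (λ i → [ p∩q⊆p C _ , p∩q⊆p C _ ]′ (x∈p∪q⁻ B D i)) , g , g∈ , λ g∈Z →
          [ (λ g∈B → b∉V₁ (proj₁ (∈induced⁻ G jg (proj₂ (x∈p∩q⁻ C _ g∈B)))))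
          , (λ g∈D → x∈∁p⇒x∉p (proj₂ (x∈p∩q⁻ C _ g∈D)) (∈induced⁺ G jg b∈W (W-step g∈ jg b∈W)))
          ]′ (x∈p∪q⁻ B D g∈Z)
          where
          b∈W : b ∈ W
          b∈W = V₂⊆W (∈reachSet⁺ G here)

        Z⊆ : Z ⊆ (I ∪ C) ∩ induced G U
        Z⊆ {g} g∈ with x∈p∪q⁻ B D g∈
        ... | inj₁ g∈B with x∈p∩q⁻ C _ g∈B
        ...   | g∈C , g∈V₁ = x∈p∩q⁺ (q⊆p∪q I C g∈C , induced-mono G (p⊆p∪q _) g∈V₁)
        Z⊆ {g} g∈ | inj₂ g∈D with x∈p∩q⁻ C _ g∈D
        ...   | g∈C , g∈∁I = x∈p∩q⁺ (q⊆p∪q I C g∈C ,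
          ∈induced⁺ G {u = src g} (inj₁ refl)
            (q⊆p∪q V₁ _ (x∉p⇒x∈∁p (end∉W (inj₁ refl)))) (q⊆p∪q V₁ _ (x∉p⇒x∈∁p (end∉W (inj₂ refl)))))
          where
          end∉W : ∀ {x y} → Joins G g x y → x ∉ W
          end∉W jg x∈ = x∈∁p⇒x∉p g∈∁I (∈induced⁺ G jg x∈ (W-step g∈C jg x∈))

        -- `Z` is independent and lies within `U`, while `a` reaches all of `W` through `I`; so
        -- `r-growth` applies to `I ∪ C`.
        lower : ∣ B ∣ + ∣ D ∣ + ∣ ∁ U ∣ ≤ r M (I ∪ C)
        lower = begin
          ∣ B ∣ + ∣ D ∣ + ∣ ∁ U ∣                   ≤⟨ +-monoˡ-≤ _ ∣B∣+∣D∣≤ ⟩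
          ∣ Z ∣ + ∣ ∁ U ∣                           ≡⟨ cong (_+ ∣ ∁ U ∣) (sym (min Z Z⊂C)) ⟩
          r M Z + ∣ ∁ U ∣                           ≤⟨ +-monoˡ-≤ _ (r-mono M _ _ Z⊆) ⟩
          r M ((I ∪ C) ∩ induced G U) + ∣ ∁ U ∣     ≤⟨ r-growth (I ∪ C) U near ⟩
          r M (I ∪ C)                               ∎
          where
          near : ∀ v → v ∉ U → ∃[ x ] (x ∈ U × Reach G (I ∪ C) x v)
          near v v∉ = a , p⊆p∪q _ (∈reachSet⁺ G here) , reach-mono G (p⊆p∪q C)
            (W-connected (x∉∁p⇒x∈p λ v∈ → v∉ (q⊆p∪q V₁ _ v∈)))

        -- The third component enters here: `f` lies outside `I`, so `C ∩ I` is a proper subset of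
        -- `C` and independent. Strictness comes from the dependence of `C`.
        upper : r M (I ∪ C) + ∣ C ∩ I ∣ < ∣ W ∣ + ∣ C ∣
        upper = begin-strict
          r M (I ∪ C) + ∣ C ∩ I ∣
            ≡⟨ cong (r M (I ∪ C) +_) (sym (min _ (p∩q⊆p C I , f , f∈ , λ f∈′ →
                 s∉W (proj₁ (∈induced⁻ G (inj₁ refl) (proj₂ (x∈p∩q⁻ C I f∈′))))))) ⟩
          r M (I ∪ C) + r M (C ∩ I)
            ≤⟨ +-monoʳ-≤ _ (r-mono M _ _ λ i →
                 x∈p∩q⁺ (proj₂ (x∈p∩q⁻ C I i) , proj₁ (x∈p∩q⁻ C I i))) ⟩
          r M (I ∪ C) + r M (I ∩ C)
            ≤⟨ r-submod M I C ⟩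
          r M I + r M C
            ≤⟨ +-monoˡ-≤ _ (r-induced≤ conn rM≤m (R⊆W {a} (∈reachSet⁺ G here))) ⟩
          ∣ W ∣ + r M C
            <⟨ +-monoʳ-< ∣ W ∣ (dependent⇒r< M dep) ⟩
          ∣ W ∣ + ∣ C ∣ ∎

    ends-in : ∀ {b f} → f ∈ C → src f ∈ reachSet G C b → ∀ w → IsEnd G w f → Reach G C b w
    ends-in f∈ s∈ w (inj₁ refl) = ∈reachSet⁻ G s∈
    ends-in f∈ s∈ w (inj₂ refl) = ∈reachSet⁻ G (reachSet-step G f∈ (inj₁ refl) s∈)

    conclusion : AtMostTwoComponents G C
    conclusion with any? (λ f → (f ∈? C) ×-dec ¬? (src f ∈? V₁))
    ... | no ¬∃ = a , a , λ f f∈ w end → inj₁ (ends-in f∈ (src∈ f f∈) w end)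
      where
      src∈ : ∀ f → f ∈ C → src f ∈ V₁
      src∈ f f∈ with src f ∈? V₁
      ... | yes s∈ = s∈
      ... | no  s∉ = contradiction (f , f∈ , s∉) ¬∃
    -- The source of `g` lies in `K`, hence outside `R`, so connectivity of `G` supplies an edge
    -- leaving `R`.
    ... | yes (g , g∈ , s∉) with reach⇒crossing G (conn a (src g)) (∈reachSet⁺ G here)
            (λ s∈R → R∩K=∅ s∈R (∈-separate⁺ other? (s∉ , g , g∈ , inj₁ refl)))
    ... | e , u , b , _ , j , u∈ , b∉ = a , b , two
      where
      two : ∀ f → f ∈ C → ∀ w → IsEnd G w f → Reach G C a w ⊎ Reach G C b w
      two f f∈ w end with src f ∈? W j u∈ b∉
      ... | no s∉W = contradiction s∉W (no-third j u∈ b∉ f∈)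
      ... | yes s∈W with W∩C j u∈ b∉ f∈ (inj₁ refl) s∈W
      ... | inj₁ s∈V₁ = inj₁ (ends-in f∈ s∈V₁ w end)
      ... | inj₂ s∈V₂ = inj₂ (ends-in f∈ s∈V₂ w end)

  connected⇒framework : Connected G → rM M ≤ m → IsFramework M G
  connected⇒framework conn rM≤m = component-rank , closed , circuit-at-most-two-components conn rM≤m
    where
    component-rank : ∀ v S X → IsComponentOf G v S X → r M X ≤ ∣ S ∣
    component-rank v S X (comp , _) = begin
      r M X          ≤⟨ r-mono M _ _ ⊆⊤ ⟩
      rM M           ≤⟨ rM≤m ⟩
      m              ≡⟨ sym (∣⊤∣≡n m) ⟩
      ∣ ⊤ {m} ∣      ≤⟨ p⊆q⇒∣p∣≤∣q∣ {p = ⊤} {S} (λ {w} _ → proj₂ (comp w) (conn v w)) ⟩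
      ∣ S ∣          ∎
      where open ≤-Reasoning

-- From a framework to a connected graph.

module _ {n m : ℕ} (M : Matroid n) (3-connected : ThreeConnected M) (G : Graph n m)
  (framework : IsFramework M G) where

  private
    component-rank = proj₁ framework
    closed = proj₁ (proj₂ framework)
    few-components = proj₂ (proj₂ framework)

    comp : Fin m → Subset m
    comp h = reachSet G ⊤ h

    edges : Fin m → Subset n
    edges h = induced G (comp h)

  isComponent : ∀ h → IsComponentOf G h (comp h) (edges h)
  isComponent h = (λ w → ∈reachSet⁻ G , ∈reachSet⁺ G) , λ e →
    (λ e∈ → _ , inj₁ refl , proj₁ (∈induced⁻ G (inj₁ refl) e∈)) ,
    λ { (w , end , w∈) → let v , j = isEnd⇒joins G end in
          ∈induced⁺ G j w∈ (reachSet-step G ∈⊤ j w∈) }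

  r-edges≤ : ∀ h → r M (edges h) ≤ ∣ comp h ∣
  r-edges≤ h = component-rank h _ _ (isComponent h)

  -- `r-edges≤` and `r-outside-component` add up to `r M X + r M (∁ X) ≤ rM M + 1`, a 2-separation
  -- if two edges lay outside.
  large-component-cofinite : ∀ {h} → 2 ≤ ∣ edges h ∣ → ∣ ∁ (edges h) ∣ ≤ 1
  large-component-cofinite {h} 2≤ = s≤s⁻¹ (≰⇒> λ 2≤∁ →
    3-connected 2 (s≤s (s≤s (s≤s z≤n))) X (2≤ , 2≤∁ , (begin-strict
      r M X + r M (∁ X)             ≤⟨ +-mono-≤ (r-edges≤ h) (r-mono M _ _ λ i → x∈p∩q⁺ (∈⊤ , i)) ⟩
      ∣ comp h ∣ + r M (⊤ ∩ ∁ X)    ≡⟨ +-comm ∣ comp h ∣ _ ⟩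
      r M (⊤ ∩ ∁ X) + ∣ comp h ∣    ≤⟨ r-outside-component M G closed ⊤ h ⟩
      suc (rM M)                    <⟨ ≤-refl ⟩
      2 + rM M                      ≡⟨ +-comm 2 (rM M) ⟩
      rM M + 2                      ∎)))
    where
    open ≤-Reasoning
    X = edges h

  -- At most one edge lies outside, so a smaller component would give `r M X + r M (∁ X) ≤ rM M`
  -- with an edge on either side, a 1-separation.
  rM≤large-component : ∀ {h} → 2 ≤ ∣ edges h ∣ → rM M ≤ ∣ comp h ∣
  rM≤large-component {h} 2≤ = ≮⇒≥ λ s<rM →
    3-connected 1 (s≤s (s≤s z≤n)) X (<⇒≤ 2≤ , 1≤∁ s<rM , (begin-strict
      r M X + r M (∁ X)         ≤⟨ +-mono-≤ (r-edges≤ h) (≤-trans (r-bound M (∁ X)) (large-component-cofinite 2≤)) ⟩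
      ∣ comp h ∣ + 1            ≡⟨ +-comm ∣ comp h ∣ 1 ⟩
      suc ∣ comp h ∣            ≤⟨ s<rM ⟩
      rM M                      <⟨ n<1+n (rM M) ⟩
      suc (rM M)                ≡⟨ +-comm 1 (rM M) ⟩
      rM M + 1                  ∎))
    where
    open ≤-Reasoning
    X = edges h
    1≤∁ : ∣ comp h ∣ < rM M → 1 ≤ ∣ ∁ X ∣
    1≤∁ s<rM = +-cancelˡ-≤ ∣ comp h ∣ _ _ (begin
      ∣ comp h ∣ + 1            ≡⟨ +-comm ∣ comp h ∣ 1 ⟩
      suc ∣ comp h ∣            ≤⟨ s<rM ⟩
      rM M                      ≤⟨ rM≤r+r∁ M X ⟩
      r M X + r M (∁ X)         ≤⟨ +-mono-≤ (r-edges≤ h) (r-bound M (∁ X)) ⟩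
      ∣ comp h ∣ + ∣ ∁ X ∣      ∎)

  edges⁺ : ∀ {X c e} → Reach G X c (proj₁ (ends G e)) → e ∈ edges c
  edges⁺ p = proj₂ (proj₂ (isComponent _) _) (_ , inj₁ refl , ∈reachSet⁺ G (reach-mono G ⊆⊤ p))

  -- Each of the at most two components of `G[C]` lies in one component of `G`, so it contributes at
  -- most one edge.
  small-components⇒small-circuit : (∀ h → ∣ edges h ∣ ≤ 1) → ∀ C → IsCircuit M C → ∣ C ∣ ≤ 2
  small-components⇒small-circuit small C circ with few-components C circ
  ... | a , b , two = ≤-trans (⊆∪⇒∣p∣≤∣p∩q∣+∣p∩r∣ cover) (+-mono-≤ (≤1 a) (≤1 b))
    where
    cover : C ⊆ edges a ∪ edges b
    cover {e} e∈ = x∈p∪q⁺ ([ (λ p → inj₁ (edges⁺ p)) , (λ p → inj₂ (edges⁺ p)) ]′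
      (two e e∈ _ (inj₁ refl)))
    ≤1 : ∀ h → ∣ C ∩ edges h ∣ ≤ 1
    ≤1 h = ≤-trans (∣p∩q∣≤∣q∣ C (edges h)) (small h)

  large-component : 2 ≤ rM M → ∃[ h ] 2 ≤ ∣ edges h ∣
  large-component 2≤rM with any? (λ h → 2 ≤? ∣ edges h ∣)
  ... | yes found = found
  ... | no ¬found with circuit-exists M 3-connected 2≤rM
  ... | C , circ = contradiction
    (small-components⇒small-circuit (λ h → s≤s⁻¹ (≰⇒> λ 2≤ → ¬found (h , 2≤))) C circ)
    (no-small-circuit M 3-connected 2≤rM circ)

  module Collapse {h : Fin m} (2≤ : 2 ≤ ∣ edges h ∣) where

    h∈ : h ∈ comp h
    h∈ = ∈reachSet⁺ G here

    open Retract (retract h∈)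

    -- Edges outside the component become loops at `retr h`, so the edge set stays `Fin n`.
    collapsed : Graph n ∣ comp h ∣
    collapsed = record { ends = λ e → retr (proj₁ (ends G e)) , retr (proj₂ (ends G e)) }

    reach-collapsed : ∀ {u w} → Reach G ⊤ u w → Reach collapsed ⊤ (retr u) (retr w)
    reach-collapsed here         = here
    reach-collapsed (fwd e _ p) = fwd e ∈⊤ (reach-collapsed p)
    reach-collapsed (bwd e _ p) = bwd e ∈⊤ (reach-collapsed p)

    collapsed-connected : Connected collapsed
    collapsed-connected i j = reach-trans collapsed (reach-sym collapsed (from-h i)) (from-h j)
      where
      from-h : ∀ i → Reach collapsed ⊤ (retr h) i
      from-h i = subst (Reach collapsed ⊤ (retr h)) (retr-incl i)
        (reach-collapsed (∈reachSet⁻ G (incl∈ i)))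

    -- By (iv) at `incl i` in `G`, `e` is a loop there or avoids `incl i`. In the second case its
    -- image can meet `i` only by the merging of outside vertices, and then it is a loop at `i`.
    collapsed-closed : ∀ i →
      cl M (edgesDel collapsed i) ⊆ (edgesDel collapsed i ∪ loopsAt collapsed i)
    collapsed-closed i {e} e∈ =
      [ from-del , (λ e∈loop → q⊆p∪q (edgesDel collapsed i) _ (from-loop e∈loop)) ]′
        (x∈p∪q⁻ _ _ (closed (incl i) (cl-mono M del⊆ e∈)))
      where
      retr≡ : ∀ {v} → v ≡ incl i → retr v ≡ i
      retr≡ refl = retr-incl i
      del⊆ : edgesDel collapsed i ⊆ edgesDel G (incl i)
      del⊆ f∈ with ∈edgesDel⁻ collapsed f∈
      ... | s≢ , t≢ = ∈edgesDel⁺ G (λ eq → s≢ (retr≡ eq)) (λ eq → t≢ (retr≡ eq))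
      from-loop : e ∈ loopsAt G (incl i) → e ∈ loopsAt collapsed i
      from-loop e∈ with ∈loopsAt⁻ G e∈
      ... | s≡ , t≡ = ∈loopsAt⁺ collapsed (retr≡ s≡) (retr≡ t≡)
      -- Here `u` must lie outside the component; then so does its neighbour `v`, and both are sent
      -- to `retr h`.
      merged : ∀ {u v} → Joins G e u v → u ≢ incl i → retr u ≡ i → retr v ≡ i
      merged {u} {v} j u≢ ru≡i with u ∈? comp h | v ∈? comp h
      ... | yes u∈ | _      = contradiction (trans (sym (incl-retr u∈)) (cong incl ru≡i)) u≢
      ... | no u∉  | yes v∈ = contradiction (reachSet-step G ∈⊤ (joins-sym G j) v∈) u∉
      ... | no u∉  | no v∉  = trans (retr-out v∉) (trans (sym (retr-out u∉)) ru≡i)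
      from-del : e ∈ edgesDel G (incl i) → e ∈ edgesDel collapsed i ∪ loopsAt collapsed i
      from-del e∈del with ∈edgesDel⁻ G e∈del
        | retr (proj₁ (ends G e)) ≟ i | retr (proj₂ (ends G e)) ≟ i
      ... | s≢ , _ | yes s≡ | _ =
        q⊆p∪q (edgesDel collapsed i) _ (∈loopsAt⁺ collapsed s≡ (merged (inj₁ refl) s≢ s≡))
      ... | _ , t≢ | no _ | yes t≡ =
        q⊆p∪q (edgesDel collapsed i) _ (∈loopsAt⁺ collapsed (merged (inj₂ refl) t≢ t≡) t≡)
      ... | _ | no s≢ | no t≢ = p⊆p∪q _ (∈edgesDel⁺ collapsed s≢ t≢)

-- The equivalence.

HasConnectedGraph : ∀ {n} → Matroid n → Set
HasConnectedGraph {n} M = ∃[ m ] Σ (Graph n m) (λ G → Connected G × (rM M ≤ m) ×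
  (∀ v → cl M (edgesDel G v) ⊆ (edgesDel G v ∪ loopsAt G v)))

-- With every element a loop at the single vertex, `loopsAt` is the whole ground set and (iv) is
-- immediate.
loops-on-one-vertex : ∀ {n} (M : Matroid n) → rM M ≤ 1 → HasConnectedGraph M
loops-on-one-vertex {n} M rM≤1 = 1 , G , (λ { zero zero → here }) , rM≤1 ,
  λ { zero {e} _ → q⊆p∪q (edgesDel G zero) _ (∈loopsAt⁺ G {e = e} refl refl) }
  where
  G : Graph n 1
  G = record { ends = λ _ → zero , zero }

theorem1p6 : ∀ {n : ℕ} (M : Matroid n) → ThreeConnected M →
    (QuasiGraphic M ⇔
    (∃[ m ] Σ (Graph n m) (λ G →
    Connected G × (rM M ≤ m) ×
    (∀ v → cl M (edgesDel G v) ⊆ (edgesDel G v ∪ loopsAt G v)))))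
theorem1p6 {n} M 3-connected = mk⇔ to from
  where
  to : QuasiGraphic M → HasConnectedGraph M
  -- Finding a component with two edges relies on `2 ≤ rM M`, so rank at most one is treated apart.
  to (m , G , framework) with rM M ≤? 1
  ... | yes rM≤1 = loops-on-one-vertex M rM≤1
  ... | no  rM≰1 = _ , collapsed , collapsed-connected ,
    rM≤large-component M 3-connected G framework (proj₂ large) , collapsed-closed
    where
    large = large-component M 3-connected G framework (≰⇒> rM≰1)
    open Collapse M 3-connected G framework (proj₂ large)
  from : HasConnectedGraph M → QuasiGraphic M
  from (m , G , conn , rM≤m , closed) = m , G , connected⇒framework M G closed conn rM≤m
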